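{- Let $r,\ell\ge1$ and $N=2(\ell+r+2)$. Let $T_{i,j,k}$ be the solution of the $\ell$-restricted $A_r$ $T$-system: $i\in[0,r+1]$, $j\in[0,\ell+1]$, $k\in\mathbb{Z}$, $i+j+k$ even, $$T_{i,j,k+1}T_{i,j,k-1}=T_{i,j+1,k}T_{i,j-1,k}+T_{i+1,j,k}T_{i-1,j,k}\qquad(i\in[1,r],\ j\in[1,\ell],\ k\in\mathbb{Z}),$$ $T_{0,j,k}=T_{r+1,j,k}=T_{i,0,k}=T_{i,\ell+1,k}=1$, with initial conditions $T_{i,j,k^{(0)}_{i,j}}=t_{i,j}$ ($i\in[1,r]$, $j\in[1,\ell]$), where $k^{(0)}_{i,j}\in\{0,1\}$ is the residue of $i+j$ mod 2 and the $t_{i,j}$ are formal variables. Then $$T_{1,j,k+\frac{N}{2}}=T_{r,\ell+1-j,k}$$ for all $k\in\mathbb{Z}$ and $j\in[1,\ell]$ such that $j+k+\ell+r$ is odd.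
   Context: The system is a three-term recursion in $k$; the initial values determine the solution uniquely as rational functions of the $t_{i,j}$. -}

module Defs where

open import Level using (Level)
open import Data.Nat using (ℕ; zero; suc; _≤_)
open import Data.Integer using (ℤ; +_) renaming (_+_ to _+ℤ_; _-_ to _-ℤ_)
open import Data.Integer.Divisibility using (_∣_)
open import Data.Product using (Σ; _×_)
open import Relation.Nullary using (¬_)
open import Algebra.Bundles using (CommutativeRing)

EvenZ : ℤ → Set
EvenZ z = (+ 2) ∣ z

OddZ : ℤ → Set
OddZ z = ¬ EvenZ z

idx : ℕ → ℕ → ℤ → ℤ
idx i j k = (+ i) +ℤ (+ j) +ℤ k

module _ {c ℓc : Level} (R : CommutativeRing c ℓc) where
  open CommutativeRing R

  IsUnit : Carrier → Set (c Level.⊔ ℓc)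
  IsUnit x = Σ Carrier (λ y → x * y ≈ 1#)

  -- T : i ↦ j ↦ k ↦ T_{i,j,k}.  Only the values with i ∈ [0,r+1], j ∈ [0,ℓ+1],
  -- i+j+k even are meaningful; values elsewhere are unconstrained and never used.
  -- IsRestrictedTSystem r ℓ T : T solves the ℓ-restricted A_r T-system.
  record IsRestrictedTSystem (r ℓ : ℕ) (T : ℕ → ℕ → ℤ → Carrier) : Set (c Level.⊔ ℓc) where
    field
      bd-i0 : ∀ j k → j ≤ suc ℓ → EvenZ (idx 0 j k) → T 0 j k ≈ 1#
      bd-ir : ∀ j k → j ≤ suc ℓ → EvenZ (idx (suc r) j k) → T (suc r) j k ≈ 1#
      bd-j0 : ∀ i k → i ≤ suc r → EvenZ (idx i 0 k) → T i 0 k ≈ 1#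
      bd-jl : ∀ i k → i ≤ suc r → EvenZ (idx i (suc ℓ) k) → T i (suc ℓ) k ≈ 1#
      -- the T-system relation, for i ∈ [1,r], j ∈ [1,ℓ], k ∈ ℤ with i+j+k odd
      -- (so that i+j+(k±1) is even)
      rel : ∀ i j k → 1 ≤ i → i ≤ r → 1 ≤ j → j ≤ ℓ → OddZ (idx i j k) →
            T i j (k +ℤ + 1) * T i j (k -ℤ + 1)
              ≈ T i (suc j) k * T i (Data.Nat._∸_ j 1) k
                + T (suc i) j k * T (Data.Nat._∸_ i 1) j k

{-# OPTIONS --safe #-}

-- Put A(p,q) = T_{1,q-p,p+q+1}.  Read as the Desnanot–Jacobi identity, the
-- T-system says that T_{i,q-p,p+q+i} is the minor of A on the rows p,…,p+i-1
-- and the columns q,…,q+i-1.  Fix a column c and let M_i(p,q) be the minor on the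
-- rows p,…,p+i-1 and the columns q,…,q+i-2,c.  No determinant is needed: M_i
-- is defined by the Desnanot–Jacobi recursion at fixed q, dividing by the units
-- T_{i,j,k}, and the Plücker relations comparing q with q+1 follow by
-- induction on i.  As T_{r+1} = 1, they imply that M_{r+1}(p,q) does not depend
-- on p.  At p = q the first r columns are unitriangular, hence
-- M_{r+1}(q,q) = A(q+r,c); for q-p = r+ℓ+1-(c-q) the last column is (0,…,0,1),
-- hence M_{r+1}(p,q) = T_r(p,q).  Equating the two values gives the theorem.

module Submission where

open import Defs
open import Data.Nat using (ℕ; zero; suc; _≤_; _<_; _∸_; z≤n; s≤s; _≤?_) renaming (_+_ to _+ℕ_)
open import Data.Nat.Divisibility using (∣⇒≤)
open import Data.Nat.Properties as ℕ using (≤-refl; ≤-reflexive; ≤-trans; n≤1+n; m≤m+n; m≤n+m)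
open import Data.Integer using (ℤ; +_) renaming (_+_ to _+ℤ_; _*_ to _*ℤ_; _-_ to _-ℤ_)
open import Data.Integer.Properties as ℤ using ()
open import Data.Integer.DivMod using (_%ℕ_; _/ℕ_; n%ℕd<d; a≡a%ℕn+[a/ℕn]*n)
open import Data.Integer.Divisibility.Signed using (divides; ∣ᵤ⇒∣; ∣⇒∣ᵤ; ∣m+n∣n⇒∣m)
open import Data.Integer.Tactic.RingSolver using (solve-∀)
open import Data.Empty using (⊥-elim)
open import Data.Product using (∃; _,_; proj₁; proj₂)
open import Data.Sum using (inj₁; inj₂)
open import Relation.Nullary using (yes; no; contradiction)
open import Relation.Binary.PropositionalEquality as ≡ using (_≡_)
open import Algebra.Bundles using (CommutativeRing)
import Algebra.Properties.Group as GroupProperties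
import Algebra.Properties.Ring as RingProperties
import Algebra.Solver.Ring.NaturalCoefficients.Default as SemiringSolver
import Relation.Binary.Reasoning.Setoid as SetoidReasoning
open import Level using (Level)

-- Cancellation of units and the algebra of the Plücker relations.

module PluckerAlgebra {a b : Level} (R : CommutativeRing a b) where
  open CommutativeRing R
  open RingProperties ring using (+-cancelʳ)
  open SetoidReasoning setoid
  open SemiringSolver commutativeSemiring using (solve; _:=_; _:+_; _:*_)

  unit-cancelˡ : ∀ {u x y} → IsUnit R u → u * x ≈ u * y → x ≈ y
  unit-cancelˡ {u} {x} {y} (v , uv≈1) ux≈uy = begin
    x             ≈⟨ *-identityˡ x ⟨
    1# * x        ≈⟨ *-congʳ uv≈1 ⟨
    (u * v) * x   ≈⟨ swap u v x ⟩
    v * (u * x)   ≈⟨ *-congˡ ux≈uy ⟩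
    v * (u * y)   ≈⟨ swap u v y ⟨
    (u * v) * y   ≈⟨ *-congʳ uv≈1 ⟩
    1# * y        ≈⟨ *-identityˡ y ⟩
    y             ∎
    where
    swap : ∀ u v x → (u * v) * x ≈ v * (u * x)
    swap = solve 3 (λ u v x → (u :* v) :* x := v :* (u :* x)) refl

  unit-* : ∀ {u v} → IsUnit R u → IsUnit R v → IsUnit R (u * v)
  unit-* {u} {v} (u⁻¹ , p) (v⁻¹ , q) = u⁻¹ * v⁻¹ , (begin
    (u * v) * (u⁻¹ * v⁻¹)  ≈⟨ solve 4 (λ u v x y → (u :* v) :* (x :* y) := (u :* x) :* (v :* y)) refl u v u⁻¹ v⁻¹ ⟩
    (u * u⁻¹) * (v * v⁻¹)  ≈⟨ *-cong p q ⟩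
    1# * 1#                ≈⟨ *-identityˡ 1# ⟩
    1#                     ∎)

  unit-resp-≈ : ∀ {u v} → u ≈ v → IsUnit R u → IsUnit R v
  unit-resp-≈ u≈v (w , uw≈1) = w , trans (*-congʳ (sym u≈v)) uw≈1

  1-unit : IsUnit R 1#
  1-unit = 1# , *-identityˡ 1#

  -- Here `m`, `n`, `o`, `h` stand for values of `M` and the other letters for values of `t`. After
  -- multiplication by `a`, the column relation replaces `m * a`, the T-system replaces `e * g`, and
  -- Desnanot-Jacobi collects a factor `a` that cancels.
  row-plucker : ∀ {m n o h a b e f g s} → IsUnit R a →
    m * a ≈ b * n + o * e → o * f + g * n ≈ a * h → b * f + a * s ≈ e * g →
    g * m ≈ s * o + b * h
  row-plucker {m} {n} {o} {h} {a} {b} {e} {f} {g} {s} a-unit p q t = unit-cancelˡ a-unit (begin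
    a * (g * m)                      ≈⟨ solve 3 (λ a g m → a :* (g :* m) := g :* (m :* a)) refl a g m ⟩
    g * (m * a)                      ≈⟨ *-congˡ p ⟩
    g * (b * n + o * e)              ≈⟨ solve 5 (λ g b n o e → g :* (b :* n :+ o :* e) := b :* (g :* n) :+ o :* (e :* g)) refl g b n o e ⟩
    b * (g * n) + o * (e * g)        ≈⟨ +-congˡ (*-congˡ t) ⟨
    b * (g * n) + o * (b * f + a * s)
      ≈⟨ solve 7 (λ g b n o f a s → b :* (g :* n) :+ o :* (b :* f :+ a :* s) := b :* (o :* f :+ g :* n) :+ a :* (s :* o)) refl g b n o f a s ⟩
    b * (o * f + g * n) + a * (s * o) ≈⟨ +-congʳ (*-congˡ q) ⟩
    b * (a * h) + a * (s * o)        ≈⟨ solve 5 (λ a b h s o → b :* (a :* h) :+ a :* (s :* o) := a :* (s :* o :+ b :* h)) refl a b h s o ⟩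
    a * (s * o + b * h)              ∎)

  -- The inductive step in the size of the minors: `w-rel` and `v-rel` are the column and row
  -- relations one size smaller, `m-rec` and `o-rec` are Desnanot-Jacobi at two adjacent values of
  -- q, and `t-rel` is the T-system.
  column-plucker-step : ∀ {m n o h v w y a b e f g s u} → IsUnit R u → IsUnit R f →
    m * u + s * v ≈ e * w → o * f + g * n ≈ a * h → w * f ≈ s * y + h * u →
    b * f + a * s ≈ e * g → f * v ≈ u * n + e * y →
    m * a ≈ b * n + o * e
  column-plucker-step {m} {n} {o} {h} {v} {w} {y} {a} {b} {e} {f} {g} {s} {u} u-unit f-unit m-rec o-rec w-rel t-rel v-rel =
    unit-cancelˡ (unit-* u-unit f-unit)
      -- Adding this term on both sides avoids subtraction, since the semiring solver knows only
      -- sums and products.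
      (+-cancelʳ ((a * s) * (u * n + e * y) + (u * e) * (g * n)) _ _ (begin
        (u * f) * (m * a) + ((a * s) * (u * n + e * y) + (u * e) * (g * n))
          ≈⟨ +-congˡ (+-congʳ (*-congˡ v-rel)) ⟨
        (u * f) * (m * a) + ((a * s) * (f * v) + (u * e) * (g * n))
          ≈⟨ solve 9 (λ u f m a s v e g n → (u :* f) :* (m :* a) :+ ((a :* s) :* (f :* v) :+ (u :* e) :* (g :* n))
                 := (a :* f) :* (m :* u :+ s :* v) :+ (u :* e) :* (g :* n)) refl u f m a s v e g n ⟩
        (a * f) * (m * u + s * v) + (u * e) * (g * n)
          ≈⟨ +-congʳ (*-congˡ m-rec) ⟩
        (a * f) * (e * w) + (u * e) * (g * n)
          ≈⟨ solve 7 (λ u f a e w g n → (a :* f) :* (e :* w) :+ (u :* e) :* (g :* n)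
                 := (a :* e) :* (w :* f) :+ (u :* e) :* (g :* n)) refl u f a e w g n ⟩
        (a * e) * (w * f) + (u * e) * (g * n)
          ≈⟨ +-congʳ (*-congˡ w-rel) ⟩
        (a * e) * (s * y + h * u) + (u * e) * (g * n)
          ≈⟨ solve 8 (λ u a e s y h g n → (a :* e) :* (s :* y :+ h :* u) :+ (u :* e) :* (g :* n)
                 := (u :* n) :* (e :* g) :+ (u :* e) :* (a :* h) :+ (a :* s) :* (e :* y)) refl u a e s y h g n ⟩
        (u * n) * (e * g) + (u * e) * (a * h) + (a * s) * (e * y)
          ≈⟨ +-congʳ (+-cong (*-congˡ t-rel) (*-congˡ o-rec)) ⟨
        (u * n) * (b * f + a * s) + (u * e) * (o * f + g * n) + (a * s) * (e * y)
          ≈⟨ solve 10 (λ u n b f a s e o g y → (u :* n) :* (b :* f :+ a :* s) :+ (u :* e) :* (o :* f :+ g :* n) :+ (a :* s) :* (e :* y)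
                 := (u :* f) :* (b :* n :+ o :* e) :+ ((a :* s) :* (u :* n :+ e :* y) :+ (u :* e) :* (g :* n))) refl u n b f a s e o g y ⟩
        (u * f) * (b * n + o * e) + ((a * s) * (u * n + e * y) + (u * e) * (g * n)) ∎))

  -- The case T_{r+1} = 1 of the column relation at two adjacent rows. The same `o` occurs in
  -- `m-rel` and `m′-rel`: constancy in p for q+1 is assumed, and constancy for q results.
  top-row-step : ∀ {m m′ n o h a e f g s} → IsUnit R a → IsUnit R g →
    m * a ≈ n + o * e → m′ * g ≈ h + o * s → o * f + g * n ≈ a * h → f + a * s ≈ e * g →
    m ≈ m′
  top-row-step {m} {m′} {n} {o} {h} {a} {e} {f} {g} {s} a-unit g-unit m-rel m′-rel o-rec t-rel =
    unit-cancelˡ (unit-* a-unit g-unit) (begin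
      (a * g) * m                    ≈⟨ solve 3 (λ a g m → (a :* g) :* m := g :* (m :* a)) refl a g m ⟩
      g * (m * a)                    ≈⟨ *-congˡ m-rel ⟩
      g * (n + o * e)                ≈⟨ solve 4 (λ g n o e → g :* (n :+ o :* e) := g :* n :+ o :* (e :* g)) refl g n o e ⟩
      g * n + o * (e * g)            ≈⟨ +-congˡ (*-congˡ t-rel) ⟨
      g * n + o * (f + a * s)
        ≈⟨ solve 6 (λ g n o f a s → g :* n :+ o :* (f :+ a :* s) := (o :* f :+ g :* n) :+ a :* (o :* s)) refl g n o f a s ⟩
      (o * f + g * n) + a * (o * s)  ≈⟨ +-congʳ o-rec ⟩
      a * h + a * (o * s)            ≈⟨ distribˡ a h (o * s) ⟨
      a * (h + o * s)                ≈⟨ *-congˡ m′-rel ⟨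
      a * (m′ * g)                   ≈⟨ solve 3 (λ a g m → a :* (m :* g) := (a :* g) :* m) refl a g m′ ⟩
      (a * g) * m′                   ∎)

-- Minors of the band matrix with a fixed last column.

module Minors {a b : Level} (R : CommutativeRing a b) where
  open CommutativeRing R

  -- t i d j stands for T_i(p,q) with q = c-d and p = q-j.
  module ColumnMinors (r ℓ : ℕ)
    (t : ℕ → ℕ → ℕ → Carrier)
    (t-bottom : ∀ d j → j ≤ suc ℓ → t 0 d j ≈ 1#)
    (t-top : ∀ d j → j ≤ suc ℓ → t (suc r) d j ≈ 1#)
    (t-left : ∀ i d → i ≤ suc r → t i d 0 ≈ 1#)
    (t-right : ∀ i d → i ≤ suc r → t i d (suc ℓ) ≈ 1#)
    (t-rel : ∀ i d j → i < r → j < ℓ →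
      t (suc (suc i)) (suc d) (suc j) * t i d (suc j) + t (suc i) d (suc (suc j)) * t (suc i) (suc d) j
        ≈ t (suc i) (suc d) (suc j) * t (suc i) d (suc j))
    (t-unit : ∀ i d j → i ≤ suc r → j ≤ suc ℓ → IsUnit R (t i d j))
    where

    open PluckerAlgebra R
    open GroupProperties +-group using (//-rightDividesˡ)
    open RingProperties ring using (+-cancelʳ)
    open SetoidReasoning setoid
    open SemiringSolver commutativeSemiring using (solve; _:=_; _:*_)

    -- The default 0 outside the strip lets `M` be a total function without bounds as arguments; the
    -- bounds return in `M-rec`.
    t⁻¹ : ℕ → ℕ → ℕ → Carrier
    t⁻¹ i d j with i ≤? suc r | j ≤? suc ℓ
    ... | yes i≤ | yes j≤ = proj₁ (t-unit i d j i≤ j≤)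
    ... | _      | _      = 0#

    t⁻¹-inverse : ∀ {i d j} → i ≤ suc r → j ≤ suc ℓ → t⁻¹ i d j * t i d j ≈ 1#
    t⁻¹-inverse {i} {d} {j} i≤ j≤ with i ≤? suc r | j ≤? suc ℓ
    ... | yes p | yes q = trans (*-comm _ _) (proj₂ (t-unit i d j p q))
    ... | no ¬p | _     = contradiction i≤ ¬p
    ... | yes _ | no ¬q = contradiction j≤ ¬q

    -- The column c of A, read upwards: column n is A(c-n,c).
    column : ℕ → Carrier
    column n with n ≤? suc ℓ
    ... | yes _ = t 1 0 n
    ... | no _  = 0#

    column-inside : ∀ {n} → n ≤ suc ℓ → column n ≈ t 1 0 n
    column-inside {n} n≤ with n ≤? suc ℓ
    ... | yes _ = refl
    ... | no ¬p = contradiction n≤ ¬p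

    column-outside : ∀ {n} → suc ℓ < n → column n ≈ 0#
    column-outside {n} n> with n ≤? suc ℓ
    ... | yes p = contradiction p (ℕ.<⇒≱ n>)
    ... | no _  = refl

    M : ℕ → ℕ → ℕ → Carrier
    M zero          d j       = 0#
    M (suc zero)    d j       = column (j +ℕ d)
    -- For `d ≤ i` the column c is repeated and the genuine minor is 0, whereas truncation gives
    -- `column 0`. The column relation at `j = 0` only needs a value that is unchanged when `i` and
    -- `d` grow together, and truncation respects this.
    M (suc (suc i)) d zero    = column (d ∸ suc i)
    M (suc (suc i)) d (suc j) =
      t⁻¹ i d j * (t (suc i) d (suc j) * M (suc i) d j - t (suc i) d j * M (suc i) d (suc j))

    M-diagonal : ∀ i d → M (suc i) d 0 ≡ column (d ∸ i)
    M-diagonal zero    d = ≡.refl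
    M-diagonal (suc i) d = ≡.refl

    -- Desnanot-Jacobi for the rows p,...,p+i+1 and the columns q,...,q+i,c, where p = q-j-1: the
    -- first and last rows and the last two columns are the ones deleted.
    M-rec : ∀ i d j → i ≤ suc r → j ≤ suc ℓ →
      M (suc (suc i)) d (suc j) * t i d j + t (suc i) d j * M (suc i) d (suc j)
        ≈ t (suc i) d (suc j) * M (suc i) d j
    M-rec i d j i≤ j≤ = trans (+-congʳ (begin
      (t⁻¹ i d j * X) * t i d j
        ≈⟨ solve 3 (λ u v x → (u :* x) :* v := (u :* v) :* x) refl (t⁻¹ i d j) (t i d j) X ⟩
      (t⁻¹ i d j * t i d j) * X  ≈⟨ *-congʳ (t⁻¹-inverse i≤ j≤) ⟩
      1# * X                     ≈⟨ *-identityˡ X ⟩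
      X                          ∎)) (//-rightDividesˡ _ _)
      where
      X = t (suc i) d (suc j) * M (suc i) d j - t (suc i) d j * M (suc i) d (suc j)

    -- Plücker relations between q and q+1.

    -- With q = c-d-1 and p = q-j, this is the three-term relation for the columns q, q+i and c, the
    -- columns between q and q+i being common. The smaller minors omit the last row p+i. It is
    -- proved together with `M-row-plucker` by induction on `i`.
    M-column-plucker : ∀ i d j → i ≤ r → j ≤ ℓ →
      M (suc i) (suc d) j * t i d (suc j)
        ≈ t (suc i) (suc d) j * M i d (suc j) + M (suc i) d (suc j) * t i (suc d) j
    -- The same three-term relation with p = q-j-1, the smaller minors omitting the first row p
    -- instead of the last.
    M-row-plucker : ∀ i d j → i ≤ r → j < ℓ →
      t i d (suc j) * M (suc i) (suc d) (suc j)
        ≈ t i (suc d) j * M (suc i) d (suc (suc j)) + t (suc i) (suc d) (suc j) * M i d (suc j)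

    M-column-plucker zero d j _ j≤ = begin
      column (j +ℕ suc d) * t 0 d (suc j)
        ≈⟨ *-cong (reflexive (≡.cong column (ℕ.+-suc j d)))
                  (trans (t-bottom d (suc j) (s≤s j≤)) (sym (t-bottom (suc d) j (≤-trans j≤ (n≤1+n ℓ))))) ⟩
      column (suc j +ℕ d) * t 0 (suc d) j
        ≈⟨ +-identityˡ _ ⟨
      0# + column (suc j +ℕ d) * t 0 (suc d) j
        ≈⟨ +-congʳ (zeroʳ (t 1 (suc d) j)) ⟨
      t 1 (suc d) j * 0# + column (suc j +ℕ d) * t 0 (suc d) j ∎
    -- The left minor is the diagonal value that `M-rec` uses at `j = 0`; the remaining discrepancy
    -- lies in factors `t _ _ 0`, which are all 1.
    M-column-plucker (suc i) d zero i< j≤ = begin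
      column (d ∸ i) * t (suc i) d 1                       ≈⟨ *-comm _ _ ⟩
      t (suc i) d 1 * column (d ∸ i)                       ≡⟨ ≡.cong (t (suc i) d 1 *_) (M-diagonal i d) ⟨
      t (suc i) d 1 * M (suc i) d 0                        ≈⟨ M-rec i d 0 i≤1+r z≤n ⟨
      M (suc (suc i)) d 1 * t i d 0 + t (suc i) d 0 * M (suc i) d 1
        ≈⟨ +-comm _ _ ⟩
      t (suc i) d 0 * M (suc i) d 1 + M (suc (suc i)) d 1 * t i d 0
        ≈⟨ +-cong (*-congʳ (trans (t-left (suc i) d (≤-trans i< (n≤1+n r))) (sym (t-left (suc (suc i)) (suc d) (s≤s i<)))))
                  (*-congˡ (trans (t-left i d i≤1+r) (sym (t-left (suc i) (suc d) (≤-trans i< (n≤1+n r)))))) ⟩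
      t (suc (suc i)) (suc d) 0 * M (suc i) d 1 + M (suc (suc i)) d 1 * t (suc i) (suc d) 0 ∎
      where
      i≤1+r = ≤-trans (n≤1+n i) (≤-trans i< (n≤1+n r))
    M-column-plucker (suc i) d (suc j) i< j< =
      column-plucker-step
        (t-unit i (suc d) j i≤1+r j≤1+ℓ)
        (t-unit i d (suc j) i≤1+r 1+j≤1+ℓ)
        (M-rec i (suc d) j i≤1+r j≤1+ℓ)
        (M-rec i d (suc j) i≤1+r 1+j≤1+ℓ)
        (M-column-plucker i d j i≤r (≤-trans (n≤1+n j) j<))
        (t-rel i d j i< j<)
        (M-row-plucker i d j i≤r j<)
      where
      i≤r = ≤-trans (n≤1+n i) i<
      i≤1+r = ≤-trans i≤r (n≤1+n r)
      1+j≤1+ℓ = ≤-trans j< (n≤1+n ℓ)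
      j≤1+ℓ = ≤-trans (n≤1+n j) 1+j≤1+ℓ

    M-row-plucker zero d j _ j< = begin
      t 0 d (suc j) * column (suc j +ℕ suc d)
        ≈⟨ *-cong (trans (t-bottom d (suc j) 1+j≤1+ℓ) (sym (t-bottom (suc d) j j≤1+ℓ)))
                  (reflexive (≡.cong column (ℕ.+-suc (suc j) d))) ⟩
      t 0 (suc d) j * column (suc (suc j) +ℕ d)
        ≈⟨ +-identityʳ _ ⟨
      t 0 (suc d) j * column (suc (suc j) +ℕ d) + 0#
        ≈⟨ +-congˡ (zeroʳ (t 1 (suc d) (suc j))) ⟨
      t 0 (suc d) j * column (suc (suc j) +ℕ d) + t 1 (suc d) (suc j) * 0# ∎
      where
      1+j≤1+ℓ = ≤-trans j< (n≤1+n ℓ)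
      j≤1+ℓ = ≤-trans (n≤1+n j) 1+j≤1+ℓ
    M-row-plucker (suc i) d j i< j< =
      row-plucker
        (t-unit (suc i) d (suc (suc j)) (≤-trans i< (n≤1+n r)) (s≤s j<))
        (M-column-plucker (suc i) d (suc j) i< j<)
        (M-rec i d (suc j) (≤-trans (n≤1+n i) (≤-trans i< (n≤1+n r))) (≤-trans j< (n≤1+n ℓ)))
        (t-rel i d j i< j<)

    -- Minors at the edge of the band and minors on consecutive columns.

    -- On all rows p,...,p+i the column c lies beyond the band, so the last column of the minor is
    -- zero.
    M-vanishes : ∀ i d j → i ≤ r → j ≤ suc ℓ → suc (suc ℓ) +ℕ i ≤ j +ℕ d → M (suc i) d j ≈ 0#
    M-vanishes zero d j _ _ h = column-outside (≤-trans (m≤m+n (suc (suc ℓ)) 0) h)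
    M-vanishes (suc i) d zero _ _ h = column-outside (ℕ.m+n≤o⇒m≤o∸n (suc (suc ℓ)) h)
    M-vanishes (suc i) d (suc j) i< j≤ h = unit-cancelˡ (t-unit i d j i≤1+r j≤1+ℓ) (begin
      t i d j * M (suc (suc i)) d (suc j)
        ≈⟨ *-comm _ _ ⟩
      M (suc (suc i)) d (suc j) * t i d j
        ≈⟨ +-identityʳ _ ⟨
      M (suc (suc i)) d (suc j) * t i d j + 0#
        ≈⟨ +-congˡ (trans (*-congˡ (M-vanishes i d (suc j) i≤r j≤ (≤-trans h′ (n≤1+n (j +ℕ d))))) (zeroʳ _)) ⟨
      M (suc (suc i)) d (suc j) * t i d j + t (suc i) d j * M (suc i) d (suc j)
        ≈⟨ M-rec i d j i≤1+r j≤1+ℓ ⟩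
      t (suc i) d (suc j) * M (suc i) d j
        ≈⟨ *-congˡ (M-vanishes i d j i≤r j≤1+ℓ h′) ⟩
      t (suc i) d (suc j) * 0#
        ≈⟨ trans (zeroʳ _) (sym (zeroʳ _)) ⟩
      t i d j * 0# ∎)
      where
      i≤r = ≤-trans (n≤1+n i) i<
      i≤1+r = ≤-trans i≤r (n≤1+n r)
      j≤1+ℓ = ≤-trans (n≤1+n j) j≤
      h′ : suc (suc ℓ) +ℕ i ≤ j +ℕ d
      h′ = ℕ.≤-pred (≤-trans (≤-reflexive (≡.sym (ℕ.+-suc (suc (suc ℓ)) i))) h)

    -- Here the column c reaches the edge of the band exactly in the last row p+i, so the last
    -- column is (0,...,0,1). In `M-rec` this makes the subtracted minor vanish.
    M-antidiagonal : ∀ i d j → i ≤ r → j ≤ suc ℓ → j +ℕ d ≡ suc ℓ +ℕ i → M (suc i) d j ≈ t i d j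
    M-antidiagonal zero d j _ j≤ h = begin
      column (j +ℕ d)     ≡⟨ ≡.cong column (≡.trans h (ℕ.+-identityʳ (suc ℓ))) ⟩
      column (suc ℓ)      ≈⟨ column-inside ≤-refl ⟩
      t 1 0 (suc ℓ)       ≈⟨ t-right 1 0 (s≤s z≤n) ⟩
      1#                  ≈⟨ t-bottom d j j≤ ⟨
      t 0 d j             ∎
    M-antidiagonal (suc i) d zero i< _ h = begin
      column (d ∸ suc i)  ≡⟨ ≡.cong column (≡.trans (≡.cong (_∸ suc i) h) (ℕ.m+n∸n≡m (suc ℓ) (suc i))) ⟩
      column (suc ℓ)      ≈⟨ column-inside ≤-refl ⟩
      t 1 0 (suc ℓ)       ≈⟨ t-right 1 0 (s≤s z≤n) ⟩
      1#                  ≈⟨ t-left (suc i) d (≤-trans i< (n≤1+n r)) ⟨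
      t (suc i) d 0       ∎
    M-antidiagonal (suc i) d (suc j) i< j≤ h = unit-cancelˡ (t-unit i d j i≤1+r j≤1+ℓ) (begin
      t i d j * M (suc (suc i)) d (suc j)
        ≈⟨ *-comm _ _ ⟩
      M (suc (suc i)) d (suc j) * t i d j
        ≈⟨ +-identityʳ _ ⟨
      M (suc (suc i)) d (suc j) * t i d j + 0#
        ≈⟨ +-congˡ (trans (*-congˡ (M-vanishes i d (suc j) i≤r j≤ (≤-reflexive (≡.cong suc (≡.sym h′))))) (zeroʳ _)) ⟨
      M (suc (suc i)) d (suc j) * t i d j + t (suc i) d j * M (suc i) d (suc j)
        ≈⟨ M-rec i d j i≤1+r j≤1+ℓ ⟩
      t (suc i) d (suc j) * M (suc i) d j
        ≈⟨ *-congˡ (M-antidiagonal i d j i≤r j≤1+ℓ h′) ⟩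
      t (suc i) d (suc j) * t i d j
        ≈⟨ *-comm _ _ ⟩
      t i d j * t (suc i) d (suc j) ∎)
      where
      i≤r = ≤-trans (n≤1+n i) i<
      i≤1+r = ≤-trans i≤r (n≤1+n r)
      j≤1+ℓ = ≤-trans (n≤1+n j) j≤
      h′ : j +ℕ d ≡ suc ℓ +ℕ i
      h′ = ℕ.suc-injective (≡.trans h (ℕ.+-suc (suc ℓ) i))

    -- For d = i-1 the last column c is q+i-1, so that the i columns are consecutive.
    M-consecutive : ∀ i j → i ≤ r → j ≤ suc ℓ → M (suc i) i j ≈ t (suc i) i j
    M-consecutive zero j _ j≤ = trans (reflexive (≡.cong column (ℕ.+-identityʳ j))) (column-inside j≤)
    M-consecutive (suc i) j i< j≤ with ℕ.m≤n⇒m<n∨m≡n j≤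
    -- The column relation stops at `j = ℓ`; the edge `j = ℓ+1` is covered by the antidiagonal
    -- value.
    ... | inj₂ ≡.refl = begin
      M (suc (suc i)) (suc i) (suc ℓ)  ≈⟨ M-antidiagonal (suc i) (suc i) (suc ℓ) i< ≤-refl ≡.refl ⟩
      t (suc i) (suc i) (suc ℓ)        ≈⟨ t-right (suc i) (suc i) (≤-trans i< (n≤1+n r)) ⟩
      1#                               ≈⟨ t-right (suc (suc i)) (suc i) (s≤s i<) ⟨
      t (suc (suc i)) (suc i) (suc ℓ)  ∎
    ... | inj₁ (s≤s j≤ℓ) = unit-cancelˡ (t-unit (suc i) i (suc j) 1+i≤1+r (s≤s j≤ℓ)) (begin
      t (suc i) i (suc j) * M (suc (suc i)) (suc i) j
        ≈⟨ *-comm _ _ ⟩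
      M (suc (suc i)) (suc i) j * t (suc i) i (suc j)
        ≈⟨ M-column-plucker (suc i) i j i< j≤ℓ ⟩
      t (suc (suc i)) (suc i) j * M (suc i) i (suc j) + M (suc (suc i)) i (suc j) * t (suc i) (suc i) j
        ≈⟨ +-cong (trans (*-congˡ (M-consecutive i (suc j) i≤r (s≤s j≤ℓ))) (*-comm _ _)) (trans (*-congʳ repeated) (zeroˡ _)) ⟩
      t (suc i) i (suc j) * t (suc (suc i)) (suc i) j + 0#
        ≈⟨ +-identityʳ _ ⟩
      t (suc i) i (suc j) * t (suc (suc i)) (suc i) j ∎)
      where
      i≤r = ≤-trans (n≤1+n i) i<
      i≤1+r = ≤-trans i≤r (n≤1+n r)
      1+i≤1+r = ≤-trans i< (n≤1+n r)
      -- With `d = i` the column c equals q+i and occurs twice; by induction the two products in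
      -- Desnanot-Jacobi coincide.
      repeated : M (suc (suc i)) i (suc j) ≈ 0#
      repeated = unit-cancelˡ (t-unit i i j i≤1+r j≤) (+-cancelʳ (t (suc i) i j * t (suc i) i (suc j)) _ _ (begin
        t i i j * M (suc (suc i)) i (suc j) + t (suc i) i j * t (suc i) i (suc j)
          ≈⟨ +-cong (*-comm _ _) (*-congˡ (sym (M-consecutive i (suc j) i≤r (s≤s j≤ℓ)))) ⟩
        M (suc (suc i)) i (suc j) * t i i j + t (suc i) i j * M (suc i) i (suc j)
          ≈⟨ M-rec i i j i≤1+r j≤ ⟩
        t (suc i) i (suc j) * M (suc i) i j
          ≈⟨ *-congˡ (M-consecutive i j i≤r j≤) ⟩
        t (suc i) i (suc j) * t (suc i) i j
          ≈⟨ *-comm _ _ ⟩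
        t (suc i) i j * t (suc i) i (suc j)
          ≈⟨ +-identityˡ _ ⟨
        0# + t (suc i) i j * t (suc i) i (suc j)
          ≈⟨ +-congʳ (zeroʳ (t i i j)) ⟨
        t i i j * 0# + t (suc i) i j * t (suc i) i (suc j) ∎))

    -- Constancy of M_{r+1} along the rows.

    -- Induction on `e` moves q away from c. At `e = 0` the columns are consecutive and both minors
    -- are T_{r+1} = 1. The step to `suc e` at `j` uses `e` at `suc j`, so the bound on the sum is
    -- preserved.
    M-top-step : 1 ≤ r → ∀ e j → suc (e +ℕ j) ≤ suc ℓ → M (suc r) (e +ℕ r) (suc j) ≈ M (suc r) (e +ℕ r) j
    M-top-step _ zero j j< = begin
      M (suc r) r (suc j)  ≈⟨ M-consecutive r (suc j) ≤-refl j< ⟩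
      t (suc r) r (suc j)  ≈⟨ t-top r (suc j) j< ⟩
      1#                   ≈⟨ t-top r j j≤ ⟨
      t (suc r) r j        ≈⟨ M-consecutive r j ≤-refl j≤ ⟨
      M (suc r) r j        ∎
      where j≤ = ≤-trans (n≤1+n j) j<
    M-top-step 1≤r@(s≤s {n = i} _) (suc e) j h =
      top-row-step
        (t-unit r d (suc (suc j)) (n≤1+n r) (s≤s j<ℓ))
        (t-unit r d (suc j) (n≤1+n r) 1+j≤1+ℓ)
        (trans (M-column-plucker r d (suc j) ≤-refl j<ℓ) (+-congʳ (one-* (t-top (suc d) (suc j) 1+j≤1+ℓ))))
        (trans (M-column-plucker r d j ≤-refl (≤-trans (n≤1+n j) j<ℓ))
               (+-cong (one-* (t-top (suc d) j (≤-trans (n≤1+n j) 1+j≤1+ℓ))) (*-congʳ (sym IH))))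
        (M-rec i d (suc j) (≤-trans (n≤1+n i) (n≤1+n r)) 1+j≤1+ℓ)
        (trans (+-congʳ (sym (one-* (t-top (suc d) (suc j) 1+j≤1+ℓ)))) (t-rel i d j ≤-refl j<ℓ))
      where
      d = e +ℕ r
      j<ℓ : j < ℓ
      j<ℓ = ≤-trans (s≤s (m≤n+m j e)) (ℕ.≤-pred h)
      1+j≤1+ℓ = ≤-trans j<ℓ (n≤1+n ℓ)
      one-* : ∀ {x y} → x ≈ 1# → x * y ≈ y
      one-* x≈1 = trans (*-congʳ x≈1) (*-identityˡ _)
      IH : M (suc r) d (suc (suc j)) ≈ M (suc r) d (suc j)
      IH = M-top-step 1≤r e (suc j) (≤-trans (≤-reflexive (≡.cong suc (ℕ.+-suc e j))) h)

    M-top-constant : 1 ≤ r → ∀ e j → e +ℕ j ≤ suc ℓ → M (suc r) (e +ℕ r) j ≈ M (suc r) (e +ℕ r) 0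
    M-top-constant _   e zero    _ = refl
    M-top-constant 1≤r e (suc j) h =
      trans (M-top-step 1≤r e j h′) (M-top-constant 1≤r e j (≤-trans (n≤1+n (e +ℕ j)) h′))
      where
      h′ = ≤-trans (≤-reflexive (≡.sym (ℕ.+-suc e j))) h

    -- For q = c-e-r the range of constancy runs from the diagonal, with value A(q+r,c), to the
    -- antidiagonal position of size r+1, which is the condition `e + j = ℓ+1`.
    half-period : 1 ≤ r → ∀ e j → e +ℕ j ≡ suc ℓ → t 1 0 e ≈ t r (e +ℕ r) j
    half-period 1≤r e j h = begin
      t 1 0 e                   ≈⟨ column-inside (≤-trans (m≤m+n e j) (≤-reflexive h)) ⟨
      column e                  ≡⟨ ≡.cong column (ℕ.m+n∸n≡m e r) ⟨
      column (e +ℕ r ∸ r)       ≡⟨ M-diagonal r (e +ℕ r) ⟨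
      M (suc r) (e +ℕ r) 0      ≈⟨ M-top-constant 1≤r e j (≤-reflexive h) ⟨
      M (suc r) (e +ℕ r) j      ≈⟨ M-antidiagonal r (e +ℕ r) j ≤-refl (≤-trans (m≤n+m j e) (≤-reflexive h)) j+d≡ ⟩
      t r (e +ℕ r) j            ∎
      where
      j+d≡ : j +ℕ (e +ℕ r) ≡ suc ℓ +ℕ r
      j+d≡ = ≡.trans (≡.sym (ℕ.+-assoc j e r)) (≡.cong (_+ℕ r) (≡.trans (ℕ.+-comm j e) h))

-- Parity of integers.

double-even : ∀ {z} m → z ≡ + 2 *ℤ m → EvenZ z
double-even m z≡ = ∣⇒∣ᵤ (divides m (≡.trans z≡ (ℤ.*-comm (+ 2) m)))

suc-double-odd : ∀ {z} m → z ≡ + 1 +ℤ + 2 *ℤ m → OddZ z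
suc-double-odd m ≡.refl 2∣z
  with ∣⇒∣ᵤ (∣m+n∣n⇒∣m {m = + 1} {n = + 2 *ℤ m} (∣ᵤ⇒∣ 2∣z) (divides m (ℤ.*-comm (+ 2) m)))
... | ∣1 = contradiction (∣⇒≤ ∣1) λ { (s≤s ()) }

odd⇒suc-double : ∀ z → OddZ z → ∃ λ m → z ≡ + 1 +ℤ + 2 *ℤ m
odd⇒suc-double z odd with z %ℕ 2 | n%ℕd<d z 2 | a≡a%ℕn+[a/ℕn]*n z 2
... | 0 | _ | z≡ = ⊥-elim (odd (double-even (z /ℕ 2) (≡.trans z≡ (≡.trans (ℤ.+-identityˡ _) (ℤ.*-comm _ (+ 2))))))
... | 1 | _ | z≡ = z /ℕ 2 , ≡.trans z≡ (≡.cong (+ 1 +ℤ_) (ℤ.*-comm (z /ℕ 2) (+ 2)))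
... | suc (suc _) | s≤s (s≤s ()) | _

-- The T-system in the coordinates of the band matrix.

module BandCoordinates {a b : Level} (R : CommutativeRing a b) (r ℓ : ℕ)
  (T : ℕ → ℕ → ℤ → CommutativeRing.Carrier R) (T-system : IsRestrictedTSystem R r ℓ T)
  (T-unit : ∀ i j k → 1 ≤ i → i ≤ r → 1 ≤ j → j ≤ ℓ → EvenZ (idx i j k) → IsUnit R (T i j k))
  (c : ℤ)
  where

  open CommutativeRing R
  open PluckerAlgebra R using (1-unit; unit-resp-≈)
  open IsRestrictedTSystem T-system

  -- This is p+q+i for q = c-d and p = q-j, the third index of T_i(p,q).
  level : ℕ → ℕ → ℕ → ℤ
  level i d j = + 2 *ℤ (c -ℤ + d) +ℤ + i -ℤ + j

  level-even : ∀ i d j → EvenZ (idx i j (level i d j))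
  level-even i d j = double-even (c -ℤ + d +ℤ + i) (identity c (+ d) (+ i) (+ j))
    where
    identity : ∀ c d i j → i +ℤ j +ℤ (+ 2 *ℤ (c -ℤ d) +ℤ i -ℤ j) ≡ + 2 *ℤ (c -ℤ d +ℤ i)
    identity = solve-∀

  t : ℕ → ℕ → ℕ → Carrier
  t i d j = T i j (level i d j)

  t-bottom : ∀ d j → j ≤ suc ℓ → t 0 d j ≈ 1#
  t-bottom d j j≤ = bd-i0 j _ j≤ (level-even 0 d j)

  t-top : ∀ d j → j ≤ suc ℓ → t (suc r) d j ≈ 1#
  t-top d j j≤ = bd-ir j _ j≤ (level-even (suc r) d j)

  t-left : ∀ i d → i ≤ suc r → t i d 0 ≈ 1#
  t-left i d i≤ = bd-j0 i _ i≤ (level-even i d 0)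

  t-right : ∀ i d → i ≤ suc r → t i d (suc ℓ) ≈ 1#
  t-right i d i≤ = bd-jl i _ i≤ (level-even i d (suc ℓ))

  t-rel : ∀ i d j → i < r → j < ℓ →
    t (suc (suc i)) (suc d) (suc j) * t i d (suc j) + t (suc i) d (suc (suc j)) * t (suc i) (suc d) j
      ≈ t (suc i) (suc d) (suc j) * t (suc i) d (suc j)
  t-rel i d j i< j< = begin
    t (suc (suc i)) (suc d) (suc j) * t i d (suc j) + t (suc i) d (suc (suc j)) * t (suc i) (suc d) j
      ≡⟨ ≡.cong₂ _+_ (≡.cong (λ k → T (suc (suc i)) (suc j) k * T i (suc j) κ) (up c (+ d) (+ i) (+ j)))
                     (≡.cong₂ _*_ (≡.cong (T (suc i) (suc (suc j))) (right c (+ d) (+ i) (+ j)))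
                                  (≡.cong (T (suc i) j) (left c (+ d) (+ i) (+ j)))) ⟩
    T (suc (suc i)) (suc j) κ * T i (suc j) κ + T (suc i) (suc (suc j)) κ * T (suc i) j κ
      ≈⟨ +-comm _ _ ⟩
    T (suc i) (suc (suc j)) κ * T (suc i) j κ + T (suc (suc i)) (suc j) κ * T i (suc j) κ
      ≈⟨ rel (suc i) (suc j) κ (s≤s z≤n) i< (s≤s z≤n) j<
             (suc-double-odd (c -ℤ + d +ℤ + i) (centre c (+ d) (+ i) (+ j))) ⟨
    T (suc i) (suc j) (κ +ℤ + 1) * T (suc i) (suc j) (κ -ℤ + 1)
      ≈⟨ *-comm _ _ ⟩
    T (suc i) (suc j) (κ -ℤ + 1) * T (suc i) (suc j) (κ +ℤ + 1)
      ≡⟨ ≡.cong₂ _*_ (≡.cong (T (suc i) (suc j)) (below c (+ d) (+ i) (+ j)))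
                     (≡.cong (T (suc i) (suc j)) (above c (+ d) (+ i) (+ j))) ⟩
    t (suc i) (suc d) (suc j) * t (suc i) d (suc j) ∎
    where
    open SetoidReasoning setoid
    -- The common height of the four factors on the left; the two factors on the right lie at
    -- `κ - 1` and `κ + 1`.
    κ = level i d (suc j)
    up : ∀ c d i j → + 2 *ℤ (c -ℤ (+ 1 +ℤ d)) +ℤ (+ 2 +ℤ i) -ℤ (+ 1 +ℤ j) ≡ + 2 *ℤ (c -ℤ d) +ℤ i -ℤ (+ 1 +ℤ j)
    up = solve-∀
    right : ∀ c d i j → + 2 *ℤ (c -ℤ d) +ℤ (+ 1 +ℤ i) -ℤ (+ 2 +ℤ j) ≡ + 2 *ℤ (c -ℤ d) +ℤ i -ℤ (+ 1 +ℤ j)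
    right = solve-∀
    left : ∀ c d i j → + 2 *ℤ (c -ℤ (+ 1 +ℤ d)) +ℤ (+ 1 +ℤ i) -ℤ j ≡ + 2 *ℤ (c -ℤ d) +ℤ i -ℤ (+ 1 +ℤ j)
    left = solve-∀
    below : ∀ c d i j → + 2 *ℤ (c -ℤ d) +ℤ i -ℤ (+ 1 +ℤ j) -ℤ + 1 ≡ + 2 *ℤ (c -ℤ (+ 1 +ℤ d)) +ℤ (+ 1 +ℤ i) -ℤ (+ 1 +ℤ j)
    below = solve-∀
    above : ∀ c d i j → + 2 *ℤ (c -ℤ d) +ℤ i -ℤ (+ 1 +ℤ j) +ℤ + 1 ≡ + 2 *ℤ (c -ℤ d) +ℤ (+ 1 +ℤ i) -ℤ (+ 1 +ℤ j)
    above = solve-∀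
    centre : ∀ c d i j → (+ 1 +ℤ i) +ℤ (+ 1 +ℤ j) +ℤ (+ 2 *ℤ (c -ℤ d) +ℤ i -ℤ (+ 1 +ℤ j)) ≡ + 1 +ℤ + 2 *ℤ (c -ℤ d +ℤ i)
    centre = solve-∀

  t-unit : ∀ i d j → i ≤ suc r → j ≤ suc ℓ → IsUnit R (t i d j)
  t-unit zero    d j       _  j≤ = unit-resp-≈ (sym (t-bottom d j j≤)) 1-unit
  t-unit (suc i) d zero    i≤ _  = unit-resp-≈ (sym (t-left (suc i) d i≤)) 1-unit
  t-unit (suc i) d (suc j) i≤ j≤ with ℕ.m≤n⇒m<n∨m≡n i≤ | ℕ.m≤n⇒m<n∨m≡n j≤
  ... | inj₂ ≡.refl   | _             = unit-resp-≈ (sym (t-top d (suc j) j≤)) 1-unit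
  ... | _             | inj₂ ≡.refl   = unit-resp-≈ (sym (t-right (suc i) d i≤)) 1-unit
  ... | inj₁ (s≤s i<) | inj₁ (s≤s j<) =
    T-unit (suc i) (suc j) _ (s≤s z≤n) i< (s≤s z≤n) j< (level-even (suc i) d (suc j))

  open Minors.ColumnMinors R r ℓ t t-bottom t-top t-left t-right t-rel t-unit public using (half-period)

-- Choice of the column c and return to the original indices.

theorem5p24 : {c ℓc : Level} (R : CommutativeRing c ℓc) (r ℓ : ℕ) → 1 ≤ r → 1 ≤ ℓ →
    (T : ℕ → ℕ → ℤ → CommutativeRing.Carrier R) →
    IsRestrictedTSystem R r ℓ T →
    (∀ i j k → 1 ≤ i → i ≤ r → 1 ≤ j → j ≤ ℓ → EvenZ (idx i j k) → IsUnit R (T i j k)) →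
    ∀ j k → 1 ≤ j → j ≤ ℓ → OddZ ((+ j) +ℤ k +ℤ (+ ℓ) +ℤ (+ r)) →
    CommutativeRing._≈_ R (T 1 j (k +ℤ (+ (ℓ +ℕ r +ℕ 2)))) (T r (suc ℓ ∸ j) k)
theorem5p24 R r ℓ 1≤r _ T T-system T-unit j k _ j≤ℓ odd = begin
  T 1 j (k +ℤ + (ℓ +ℕ r +ℕ 2))   ≡⟨ ≡.cong (T 1 j) upper ⟩
  t 1 0 j                        ≈⟨ half-period 1≤r j J j+J≡ ⟩
  t r (j +ℕ r) J                 ≡⟨ ≡.cong (T r J) lower ⟩
  T r J k                        ∎
  where
  J = suc ℓ ∸ j
  j+J≡ : j +ℕ J ≡ suc ℓ
  j+J≡ = ℕ.m+[n∸m]≡n (≤-trans j≤ℓ (n≤1+n ℓ))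
  z = (+ j) +ℤ k +ℤ (+ ℓ) +ℤ (+ r)
  m = proj₁ (odd⇒suc-double z odd)
  z≡ : z ≡ + 1 +ℤ + 2 *ℤ m
  z≡ = proj₂ (odd⇒suc-double z odd)
  -- The height 2c+1-j of `t 1 0 j` must equal k+ℓ+r+2, so 2c = z+1; as z = 1+2m is odd, c = 1+m.
  open BandCoordinates R r ℓ T T-system T-unit (+ 1 +ℤ m)
  open SetoidReasoning (CommutativeRing.setoid R)

  upper : k +ℤ + (ℓ +ℕ r +ℕ 2) ≡ level 1 0 j
  upper = ≡.trans (from-z (+ j) k (+ ℓ) (+ r)) (≡.trans (≡.cong (λ z → z +ℤ + 2 -ℤ + j) z≡) (to-level m (+ j)))
    where
    from-z : ∀ j k ℓ r → k +ℤ (ℓ +ℤ r +ℤ + 2) ≡ j +ℤ k +ℤ ℓ +ℤ r +ℤ + 2 -ℤ j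
    from-z = solve-∀
    to-level : ∀ m j → + 1 +ℤ + 2 *ℤ m +ℤ + 2 -ℤ j ≡ + 2 *ℤ (+ 1 +ℤ m -ℤ + 0) +ℤ + 1 -ℤ j
    to-level = solve-∀

  lower : level r (j +ℕ r) J ≡ k
  lower = ≡.trans (from-level m (+ j) (+ r) (+ J))
         (≡.trans (≡.cong₂ (λ z s → z +ℤ + 1 -ℤ + r -ℤ + j -ℤ s) (≡.sym z≡) (≡.cong +_ j+J≡))
                  (to-k (+ j) k (+ ℓ) (+ r)))
    where
    from-level : ∀ m j r J → + 2 *ℤ (+ 1 +ℤ m -ℤ (j +ℤ r)) +ℤ r -ℤ J ≡ + 1 +ℤ + 2 *ℤ m +ℤ + 1 -ℤ r -ℤ j -ℤ (j +ℤ J)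
    from-level = solve-∀
    to-k : ∀ j k ℓ r → j +ℤ k +ℤ ℓ +ℤ r +ℤ + 1 -ℤ r -ℤ j -ℤ (+ 1 +ℤ ℓ) ≡ k
    to-k = solve-∀
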